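{- Let $f,g:\mathbb{N}\to\mathbb{N}$ be functions with $n^{2}=o(f(n))$ and $g(n)=o(n^{3})$ as $n\to\infty$, and let $l:\mathbb{N}\to\mathbb{N}$ satisfy $f(n)\le l(n)\le g(n)$ for every $n\in\mathbb{N}$. Then there exists a function $h:\mathbb{N}\to\mathbb{N}$ with $h(n)\sim \frac{5\,l(n)^{2}}{\alpha_n}$ as $n\to\infty$ such that for every $n\in\mathbb{N}$ $$\frac{l(n)^{2}}{\alpha_n}\le r(l(n))\le h(n).$$
   Context: For $n\in\mathbb{N}$ let $G_n=G(n,3,1)$ be the graph whose vertex set $V_n$ consists of all $3$-element subsets of $\{1,\dots,n\}$, two vertices being adjacent if and only if the corresponding sets share exactly one element. Let $\alpha_n$ denote the independence number of $G(n,3,1)$. For $W\subseteq V_n$ let $r(W)$ be the number of edges of $G(n,3,1)$ with both endpoints in $W$, and for an integer $0\le l\le \binom{n}{3}$ let $r(l)=\min\{r(W): W\subseteq V_n,\ |W|=l\}$ (so $r(l(n))$ is computed in $G(n,3,1)$).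
   Formalization: The lower bound is proved for all sufficiently large n, not every n (it fails e.g. for n=4, l(4)=1, where α_4=4 and r(1)=0, and α_n=0 for n<3); the upper bound is stated for every n with l(n) ≤ C(n,3), which is shown to hold for all large n. -}

module Defs where

open import Data.Fin.Subset using (Subset; inside; outside; _∩_; ∣_∣)
open import Data.Integer.Base using (+_)
open import Data.List.Base using (List; []; _∷_; [_]; _++_; map; filter; length)
open import Data.List.Extrema.Nat using (min; max)
open import Data.List.Relation.Unary.AllPairs using (AllPairs; allPairs?)
open import Data.Nat.Base as ℕ using (ℕ; zero; suc)
import Data.Nat.Properties as ℕ
open import Data.Product.Base using (∃-syntax)
open import Data.Rational.Unnormalised.Base as ℚ using (ℚᵘ; 0ℚᵘ)
open import Data.Vec.Base using ([]; _∷_)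
open import Relation.Binary.PropositionalEquality.Core using (_≡_)
open import Relation.Nullary.Decidable.Core using (Dec; ¬?)
open import Relation.Nullary.Negation.Core using (¬_)

allSubsets : (n : ℕ) → List (Subset n)
allSubsets zero    = [ [] ]
allSubsets (suc n) = map (inside ∷_) (allSubsets n) ++ map (outside ∷_) (allSubsets n)

-- The ground set {1,…,n} is Fin n.  The list has no repetitions, so the
-- subsets W ⊆ V n correspond bijectively to the elements of sublists (V n),
-- with ∣W∣ the length.
V : (n : ℕ) → List (Subset n)
V n = filter (λ s → ∣ s ∣ ℕ.≟ 3) (allSubsets n)

Adjacent : ∀ {n} → Subset n → Subset n → Set
Adjacent s t = ∣ s ∩ t ∣ ≡ 1

adjacent? : ∀ {n} (s t : Subset n) → Dec (Adjacent s t)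
adjacent? s t = ∣ s ∩ t ∣ ℕ.≟ 1

sublists : ∀ {A : Set} → List A → List (List A)
sublists []       = [ [] ]
sublists (x ∷ xs) = map (x ∷_) (sublists xs) ++ sublists xs

Independent : ∀ {n} → List (Subset n) → Set
Independent = AllPairs (λ s t → ¬ Adjacent s t)

independent? : ∀ {n} (W : List (Subset n)) → Dec (Independent W)
independent? = allPairs? (λ s t → ¬? (adjacent? s t))

α : ℕ → ℕ
α n = max 0 (map length (filter independent? (sublists (V n))))

-- r(W): each unordered pair of members is inspected once.
edges : ∀ {n} → List (Subset n) → ℕ
edges []      = 0
edges (s ∷ W) = length (filter (adjacent? s) W) ℕ.+ edges W

-- r(l), computed in G(n,3,1).  The first argument of min is only a default for
-- the empty list, i.e. for l > n C 3; it is at least edges W for every W ⊆ V n,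
-- so it does not influence the minimum when l ≤ n C 3.
r : (n l : ℕ) → ℕ
r n l = min (edges (V n)) (map edges (filter (λ W → length W ℕ.≟ l) (sublists (V n))))

fromℕ : ℕ → ℚᵘ
fromℕ m = + m ℚ./ 1

-- Quotient of naturals, with value 0 for denominator 0.  Note α n = 0 only
-- for n < 3.
_÷_ : ℕ → ℕ → ℚᵘ
m ÷ zero    = 0ℚᵘ
m ÷ (suc d) = + m ℚ./ suc d

Eventually : (ℕ → Set) → Set
Eventually P = ∃[ N ] (∀ n → N ℕ.≤ n → P n)

_=o_ : (a b : ℕ → ℚᵘ) → Set
a =o b = ∀ ε → 0ℚᵘ ℚ.< ε → Eventually λ n → ℚ.∣ a n ∣ ℚ.≤ ε ℚ.* ℚ.∣ b n ∣

_∼_ : (a b : ℕ → ℚᵘ) → Set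
a ∼ b = (λ n → a n ℚ.- b n) =o b

{-# OPTIONS --safe #-}
module Submission where

-- In fact r(l) ~ (9/2) l² / n throughout the range n² ≪ l ≪ n³, while
-- n - 2 ≤ α n ≤ n.
--
-- Lower bound: for a family W of l triples, Σ_{s,t ∈ W} ∣s ∩ t∣ = Σ_x d(x)²,
-- where d(x) is the number of members containing x.  As Σ_x d(x) = 3 l,
-- Cauchy–Schwarz gives at least 9 l² / n.  Each s has at most 3 n triples t with
-- ∣s ∩ t∣ ≥ 2, so all but O(n l) = o(l² / n) of this sum comes from edges, each
-- of which is counted twice.
--
-- Upper bound: deleting vertices of above-average degree one by one from V n
-- leaves l triples spanning at most the average number of edges of an l-subset,
-- and V n is regular, which makes Cauchy–Schwarz an equality there.
--
-- α n ≥ n - 2 is witnessed by the triples through two fixed points; α n ≤ n is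
-- the oddtown argument over 𝔽₂, since distinct non-adjacent triples meet in an
-- even number of points.

open import Defs
open import Algebra.Properties.CommutativeSemigroup using (interchange)
open import Data.Bool.Base using (Bool; true; false; if_then_else_; not; _∧_; _xor_)
open import Data.Bool.Properties using (xor-identityʳ)
open import Data.Empty using (⊥)
open import Data.Fin.Base using (Fin; zero; suc)
open import Data.Fin.Subset using (Subset; inside; outside; _∩_; ∣_∣)
open import Data.Fin.Subset.Properties using (∣p∩q∣≤∣p∣; ∣p∩q∣≤∣q∣; ∩-idem; ∩-comm)
import Data.Integer.Properties as ℤ
open import Data.List.Base using (List; []; _∷_; _++_; map; filter; length; allFin)
open import Data.List.Extrema.Nat using (max≤v⁺; v≤max⁺; min≤v⁺; argmin-all)
open import Data.List.Membership.Propositional using (_∈_; lose)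
open import Data.List.Membership.Propositional.Properties
  using (∈-++⁺ˡ; ∈-++⁺ʳ; ∈-++⁻; ∈-map⁺; ∈-map⁻; ∈-filter⁺; ∈-filter⁻)
open import Data.List.Properties
  using (map-tabulate; filter-++; filter-≐; filter-none; length-++; length-map; map-++; map-∘; map-cong; length-tabulate)
open import Data.List.Relation.Binary.Sublist.Propositional using (_⊆_; []; _∷_; _∷ʳ_; ⊆-refl; ⊆-trans)
open import Data.List.Relation.Binary.Sublist.Propositional.Properties
  using (All-resp-⊆; ++⁺ʳ) renaming (map⁺ to ⊆-map⁺)
open import Data.List.Relation.Unary.All as All using (All; []; _∷_)
import Data.List.Relation.Unary.All.Properties as All
open import Data.List.Relation.Unary.AllPairs using (AllPairs; []; _∷_)
import Data.List.Relation.Unary.AllPairs.Properties as AllPairs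
open import Data.List.Relation.Unary.Any using (here; there)
import Data.List.Relation.Unary.Any.Properties as Any
open import Data.List.Relation.Unary.Unique.Propositional using (Unique)
import Data.List.Relation.Unary.Unique.Propositional.Properties as Unique
open import Data.Nat.Base using (ℕ; zero; suc; _+_; _*_; _∸_; _^_; _≤_; _<_; _⊔_; z≤n; s≤s; >-nonZero)
open import Data.Nat.Combinatorics using (_C_; nC1≡n; nCk+nC[k+1]≡[n+1]C[k+1])
open import Data.Nat.DivMod using (_/_; _%_; m≡m%n+[m/n]*n; m%n<n; m*n/n≡m; /-monoˡ-≤)
open import Data.Nat.ListAction using (sum)
open import Data.Nat.ListAction.Properties using (sum-++)
open import Data.Nat.Properties
open import Data.Nat.Tactic.RingSolver using (solve-∀)
open import Data.Product.Base using (_×_; _,_; proj₁; proj₂; ∃-syntax; Σ-syntax)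
open import Data.Rational.Unnormalised.Base as ℚ using (mkℚᵘ; *≤*; *<*)
open import Data.Sum.Base using (inj₁; inj₂)
open import Data.Vec.Base using (Vec; []; _∷_; lookup; zipWith)
open import Data.Vec.Properties using (∷-injectiveʳ)
open import Function.Base using (_∘_; id)
open import Level using (0ℓ)
open import Relation.Binary.PropositionalEquality
open import Relation.Nullary.Decidable.Core using (Dec; yes; no; does)
open import Relation.Nullary.Negation.Core using (¬_; contradiction)
open import Relation.Unary using (Pred; Decidable)

private
  variable
    A B : Set
    n : ℕ

-- Finite sums

∑ : (A → ℕ) → List A → ℕ
∑ f xs = sum (map f xs)

∑-cong : ∀ {f g : A → ℕ} → (∀ x → f x ≡ g x) → ∀ xs → ∑ f xs ≡ ∑ g xs
∑-cong eq xs = cong sum (map-cong eq xs)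

∑-++ : ∀ (f : A → ℕ) xs ys → ∑ f (xs ++ ys) ≡ ∑ f xs + ∑ f ys
∑-++ f xs ys = trans (cong sum (map-++ f xs ys)) (sum-++ (map f xs) (map f ys))

∑-map : ∀ (f : B → ℕ) (g : A → B) xs → ∑ f (map g xs) ≡ ∑ (f ∘ g) xs
∑-map f g xs = cong sum (sym (map-∘ xs))

∑-mono : ∀ {f g : A → ℕ} {xs} → All (λ x → f x ≤ g x) xs → ∑ f xs ≤ ∑ g xs
∑-mono []       = z≤n
∑-mono (p ∷ ps) = +-mono-≤ p (∑-mono ps)

∑-≤-const : ∀ {f : A → ℕ} {c xs} → All (λ x → f x ≤ c) xs → ∑ f xs ≤ length xs * c
∑-≤-const []       = z≤n
∑-≤-const (p ∷ ps) = +-mono-≤ p (∑-≤-const ps)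

∑-const : ∀ {f : A → ℕ} {c xs} → All (λ x → f x ≡ c) xs → ∑ f xs ≡ length xs * c
∑-const []       = refl
∑-const (p ∷ ps) = cong₂ _+_ p (∑-const ps)

∑-+ : ∀ (f g : A → ℕ) xs → ∑ (λ x → f x + g x) xs ≡ ∑ f xs + ∑ g xs
∑-+ f g []       = refl
∑-+ f g (x ∷ xs) = trans (cong (f x + g x +_) (∑-+ f g xs))
  (interchange +-commutativeSemigroup (f x) (g x) (∑ f xs) (∑ g xs))

∑-*ˡ : ∀ c (f : A → ℕ) xs → ∑ (λ x → c * f x) xs ≡ c * ∑ f xs
∑-*ˡ c f []       = sym (*-zeroʳ c)
∑-*ˡ c f (x ∷ xs) = trans (cong (c * f x +_) (∑-*ˡ c f xs)) (sym (*-distribˡ-+ c (f x) (∑ f xs)))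

∑-*ʳ : ∀ c (f : A → ℕ) xs → ∑ (λ x → f x * c) xs ≡ ∑ f xs * c
∑-*ʳ c f []       = refl
∑-*ʳ c f (x ∷ xs) = trans (cong (f x * c +_) (∑-*ʳ c f xs)) (sym (*-distribʳ-+ c (f x) (∑ f xs)))

∑-swap : ∀ (f : A → B → ℕ) xs ys → ∑ (λ x → ∑ (f x) ys) xs ≡ ∑ (λ y → ∑ (λ x → f x y) xs) ys
∑-swap f []       ys = sym (trans (∑-const (All.universal (λ _ → refl) ys)) (*-zeroʳ (length ys)))
∑-swap f (x ∷ xs) ys = trans (cong (∑ (f x) ys +_) (∑-swap f xs ys))
  (sym (∑-+ (f x) (λ y → ∑ (λ x → f x y) xs) ys))

∑-⊆ : ∀ (f : A → ℕ) {xs ys} → xs ⊆ ys → ∑ f xs ≤ ∑ f ys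
∑-⊆ f []         = z≤n
∑-⊆ f (y ∷ʳ τ)   = ≤-trans (∑-⊆ f τ) (m≤n+m _ (f y))
∑-⊆ f (refl ∷ τ) = +-monoʳ-≤ _ (∑-⊆ f τ)

∑-allFin : ∀ {n} (f : Fin (suc n) → ℕ) → ∑ f (allFin (suc n)) ≡ f zero + ∑ (f ∘ suc) (allFin n)
∑-allFin f = cong (f zero +_) (trans (cong sum (map-tabulate suc f)) (cong sum (sym (map-tabulate (λ x → x) (f ∘ suc)))))

-- Induction step of Cauchy-Schwarz: an entry `a` joins `m` entries with sum `s` and sum of squares
-- `d`. After scaling by `m`, the cross term `2 * (m * a * s)` is at most `(m * a)² + s²`. That
-- scaling cannot be undone for `m = 0`, where the hypothesis forces `s = 0` instead.
cauchy-step : ∀ m a s d → s * s ≤ m * d → (a + s) * (a + s) ≤ suc m * (a * a + d)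
cauchy-step zero    a zero d _   = subst₂ _≤_ (e₁ a) (e₂ a d) (m≤m+n (a * a) d)
  where
  e₁ : ∀ a → a * a ≡ (a + 0) * (a + 0)
  e₁ = solve-∀
  e₂ : ∀ a d → a * a + d ≡ 1 * (a * a + d)
  e₂ = solve-∀
cauchy-step m@(suc _) a s d hyp = *-cancelˡ-≤ m (begin
  m * ((a + s) * (a + s))                       ≡⟨ e₁ m a s ⟩
  m * (a * a) + m * (s * s) + 2 * (m * a * s)   ≤⟨ +-monoʳ-≤ (m * (a * a) + m * (s * s)) (2xy≤x²+y² (m * a) s) ⟩
  m * (a * a) + m * (s * s) + (m * a * (m * a) + s * s) ≡⟨ e₂ m a s ⟩
  m * (suc m * (a * a)) + suc m * (s * s)       ≤⟨ +-monoʳ-≤ (m * (suc m * (a * a))) (*-monoʳ-≤ (suc m) hyp) ⟩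
  m * (suc m * (a * a)) + suc m * (m * d)       ≡⟨ e₃ m a d ⟩
  m * (suc m * (a * a + d))                     ∎)
  where
  open ≤-Reasoning
  e₁ : ∀ m a s → m * ((a + s) * (a + s)) ≡ m * (a * a) + m * (s * s) + 2 * (m * a * s)
  e₁ = solve-∀
  e₂ : ∀ m a s → m * (a * a) + m * (s * s) + (m * a * (m * a) + s * s) ≡ m * (suc m * (a * a)) + suc m * (s * s)
  e₂ = solve-∀
  e₃ : ∀ m a d → m * (suc m * (a * a)) + suc m * (m * d) ≡ m * (suc m * (a * a + d))
  e₃ = solve-∀
  ordered : ∀ x k → 2 * (x * (x + k)) ≤ x * x + (x + k) * (x + k)
  ordered x k = subst (2 * (x * (x + k)) ≤_) (e x k) (m≤m+n _ (k * k))
    where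
    e : ∀ x k → 2 * (x * (x + k)) + k * k ≡ x * x + (x + k) * (x + k)
    e = solve-∀
  2xy≤x²+y² : ∀ x y → 2 * (x * y) ≤ x * x + y * y
  2xy≤x²+y² x y with ≤-total x y
  ... | inj₁ x≤y = subst (λ z → 2 * (x * z) ≤ x * x + z * z) (m+[n∸m]≡n x≤y) (ordered x (y ∸ x))
  ... | inj₂ y≤x = subst₂ _≤_ (cong (2 *_) (*-comm y x)) (+-comm (y * y) (x * x))
                     (subst (λ z → 2 * (y * z) ≤ y * y + z * z) (m+[n∸m]≡n y≤x) (ordered y (x ∸ y)))

cauchy-schwarz : ∀ (f : A → ℕ) xs → ∑ f xs * ∑ f xs ≤ length xs * ∑ (λ x → f x * f x) xs
cauchy-schwarz f []       = z≤n
cauchy-schwarz f (x ∷ xs) = cauchy-step (length xs) (f x) (∑ f xs) _ (cauchy-schwarz f xs)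

indicator : ∀ {P : Set} → Dec P → ℕ
indicator p = if does p then 1 else 0

length-filter-∑ : ∀ {P : Pred A 0ℓ} (P? : Decidable P) xs → length (filter P? xs) ≡ ∑ (indicator ∘ P?) xs
length-filter-∑ P? []       = refl
length-filter-∑ P? (x ∷ xs) with does (P? x)
... | true  = cong suc (length-filter-∑ P? xs)
... | false = length-filter-∑ P? xs

filter-map : ∀ {P : Pred B 0ℓ} (P? : Decidable P) (f : A → B) xs →
             filter P? (map f xs) ≡ map f (filter (P? ∘ f) xs)
filter-map P? f []       = refl
filter-map P? f (x ∷ xs) with does (P? (f x))
... | true  = cong (f x ∷_) (filter-map P? f xs)
... | false = filter-map P? f xs

-- Subsets of a given size

layer : (n k : ℕ) → List (Subset n)
layer n k = filter (λ s → ∣ s ∣ ≟ k) (allSubsets n)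

layer-sizes : ∀ n k → All (λ s → ∣ s ∣ ≡ k) (layer n k)
layer-sizes n k = All.all-filter (λ s → ∣ s ∣ ≟ k) (allSubsets n)

layer-suc : ∀ n k → layer (suc n) (suc k) ≡ map (inside ∷_) (layer n k) ++ map (outside ∷_) (layer n (suc k))
layer-suc n k = trans (filter-++ P? (map (inside ∷_) (allSubsets n)) _) (cong₂ _++_
  (trans (filter-map P? (inside ∷_) (allSubsets n))
    (cong (map (inside ∷_)) (filter-≐ _ (λ s → ∣ s ∣ ≟ k) (suc-injective , cong suc) (allSubsets n))))
  (filter-map P? (outside ∷_) (allSubsets n)))
  where P? = λ (s : Subset (suc n)) → ∣ s ∣ ≟ suc k

layer-zero : ∀ n → layer (suc n) 0 ≡ map (outside ∷_) (layer n 0)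
layer-zero n = trans (filter-++ P? (map (inside ∷_) (allSubsets n)) _) (cong₂ _++_
  (trans (filter-map P? (inside ∷_) (allSubsets n))
    (cong (map (inside ∷_)) (filter-none _ (All.universal (λ _ ()) (allSubsets n)))))
  (filter-map P? (outside ∷_) (allSubsets n)))
  where P? = λ (s : Subset (suc n)) → ∣ s ∣ ≟ 0

∑-layer : ∀ n k (f : Subset (suc n) → ℕ) →
  ∑ f (layer (suc n) (suc k)) ≡ ∑ (f ∘ (inside ∷_)) (layer n k) + ∑ (f ∘ (outside ∷_)) (layer n (suc k))
∑-layer n k f = begin
  ∑ f (layer (suc n) (suc k))
    ≡⟨ cong (∑ f) (layer-suc n k) ⟩
  ∑ f (map (inside ∷_) (layer n k) ++ map (outside ∷_) (layer n (suc k)))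
    ≡⟨ ∑-++ f (map (inside ∷_) (layer n k)) _ ⟩
  ∑ f (map (inside ∷_) (layer n k)) + ∑ f (map (outside ∷_) (layer n (suc k)))
    ≡⟨ cong₂ _+_ (∑-map f (inside ∷_) (layer n k)) (∑-map f (outside ∷_) (layer n (suc k))) ⟩
  ∑ (f ∘ (inside ∷_)) (layer n k) + ∑ (f ∘ (outside ∷_)) (layer n (suc k)) ∎
  where open ≡-Reasoning

length-layer : ∀ n k → length (layer n k) ≡ n C k
length-layer zero    zero    = refl
length-layer zero    (suc k) = refl
length-layer (suc n) zero    = trans (cong length (layer-zero n))
  (trans (length-map (outside ∷_) (layer n 0)) (length-layer n 0))
length-layer (suc n) (suc k) = begin
  length (layer (suc n) (suc k))
    ≡⟨ cong length (layer-suc n k) ⟩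
  length (map (inside ∷_) (layer n k) ++ map (outside ∷_) (layer n (suc k)))
    ≡⟨ length-++ (map (inside ∷_) (layer n k)) ⟩
  length (map (inside ∷_) (layer n k)) + length (map (outside ∷_) (layer n (suc k)))
    ≡⟨ cong₂ _+_ (trans (length-map _ (layer n k)) (length-layer n k))
                 (trans (length-map _ (layer n (suc k))) (length-layer n (suc k))) ⟩
  n C k + n C suc k
    ≡⟨ nCk+nC[k+1]≡[n+1]C[k+1] n k ⟩
  suc n C suc k ∎
  where open ≡-Reasoning

-- Double counting of intersections

χ : Subset n → Fin n → ℕ
χ s x = if lookup s x then 1 else 0

degree : List (Subset n) → Fin n → ℕ
degree W x = ∑ (λ s → χ s x) W

∑-χ : ∀ {n} (s : Subset n) → ∑ (χ s) (allFin n) ≡ ∣ s ∣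
∑-χ []            = refl
∑-χ (inside ∷ s)  = trans (∑-allFin (χ (inside ∷ s))) (cong suc (∑-χ s))
∑-χ (outside ∷ s) = trans (∑-allFin (χ (outside ∷ s))) (∑-χ s)

χ-∩ : ∀ (s t : Subset n) x → χ (s ∩ t) x ≡ χ s x * χ t x
χ-∩ (inside ∷ s)  (inside ∷ t)  zero = refl
χ-∩ (inside ∷ s)  (outside ∷ t) zero = refl
χ-∩ (outside ∷ s) (_ ∷ t)       zero = refl
χ-∩ (_ ∷ s)       (_ ∷ t)       (suc x) = χ-∩ s t x

∑-degree : ∀ (W : List (Subset n)) → ∑ (degree W) (allFin n) ≡ ∑ ∣_∣ W
∑-degree {n} W = trans (∑-swap (λ x s → χ s x) (allFin n) W) (∑-cong ∑-χ W)

pairSum : (A → A → ℕ) → List A → ℕ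
pairSum φ W = ∑ (λ s → ∑ (φ s) W) W

intersections : List (Subset n) → ℕ
intersections = pairSum (λ s t → ∣ s ∩ t ∣)

-- Once `∣ s ∩ t ∣` is expanded as a sum over points `x` and `x` is moved outermost, the sums over
-- `s` and `t` separate into two factors.
intersections-degree : ∀ (W : List (Subset n)) →
  intersections W ≡ ∑ (λ x → degree W x * degree W x) (allFin n)
intersections-degree {n} W = begin
  ∑ (λ s → ∑ (λ t → ∣ s ∩ t ∣) W) W
    ≡⟨ ∑-cong (λ s → ∑-cong (λ t → trans (sym (∑-χ (s ∩ t))) (∑-cong (χ-∩ s t) (allFin n))) W) W ⟩
  ∑ (λ s → ∑ (λ t → ∑ (λ x → χ s x * χ t x) (allFin n)) W) W
    ≡⟨ ∑-cong (λ s → ∑-swap (λ t x → χ s x * χ t x) W (allFin n)) W ⟩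
  ∑ (λ s → ∑ (λ x → ∑ (λ t → χ s x * χ t x) W) (allFin n)) W
    ≡⟨ ∑-cong (λ s → ∑-cong (λ x → ∑-*ˡ (χ s x) (λ t → χ t x) W) (allFin n)) W ⟩
  ∑ (λ s → ∑ (λ x → χ s x * degree W x) (allFin n)) W
    ≡⟨ ∑-swap (λ s x → χ s x * degree W x) W (allFin n) ⟩
  ∑ (λ x → ∑ (λ s → χ s x * degree W x) W) (allFin n)
    ≡⟨ ∑-cong (λ x → ∑-*ʳ (degree W x) (λ s → χ s x) W) (allFin n) ⟩
  ∑ (λ x → degree W x * degree W x) (allFin n) ∎
  where open ≡-Reasoning

-- Induction on the position of `x`: the sets through the first point are a copy of `layer n k`, and
-- for a later point the two halves of the layer add up by Pascal's rule. That the degree does not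
-- depend on `x` is the regularity used in `edges-V`.
degree-layer : ∀ n k (x : Fin (suc n)) → degree (layer (suc n) (suc k)) x ≡ n C k
degree-layer n k zero = begin
  degree (layer (suc n) (suc k)) zero
    ≡⟨ ∑-layer n k (λ s → χ s zero) ⟩
  ∑ (λ _ → 1) (layer n k) + ∑ (λ _ → 0) (layer n (suc k))
    ≡⟨ cong₂ _+_ (∑-const (All.universal (λ _ → refl) (layer n k)))
                 (∑-const (All.universal (λ _ → refl) (layer n (suc k)))) ⟩
  length (layer n k) * 1 + length (layer n (suc k)) * 0
    ≡⟨ cong₂ _+_ (*-identityʳ _) (*-zeroʳ (length (layer n (suc k)))) ⟩
  length (layer n k) + 0
    ≡⟨ trans (+-identityʳ _) (length-layer n k) ⟩
  n C k ∎
  where open ≡-Reasoning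
-- Pascal's rule does not reach `k = 0`: here the sets through the first point come from the empty
-- set, which contains no `x`.
degree-layer (suc n) zero (suc x) = begin
  degree (layer (suc (suc n)) 1) (suc x)
    ≡⟨ ∑-layer (suc n) 0 (λ s → χ s (suc x)) ⟩
  degree (layer (suc n) 0) x + degree (layer (suc n) 1) x
    ≡⟨ cong₂ _+_ (trans (cong (λ W → degree W x) (layer-zero n)) (empty n x)) (degree-layer n 0 x) ⟩
  0 + 1 ∎
  where
  open ≡-Reasoning
  empty : ∀ n (x : Fin (suc n)) → degree (map (outside ∷_) (layer n 0)) x ≡ 0
  empty n zero = trans (∑-map (λ s → χ s zero) (outside ∷_) (layer n 0))
    (trans (∑-const (All.universal (λ _ → refl) (layer n 0))) (*-zeroʳ (length (layer n 0))))
  empty (suc n) (suc x) = trans (∑-map (λ s → χ s (suc x)) (outside ∷_) (layer (suc n) 0))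
    (trans (cong (λ W → degree W x) (layer-zero n)) (empty n x))
degree-layer (suc n) (suc k) (suc x) =
  trans (∑-layer (suc n) (suc k) (λ s → χ s (suc x)))
    (trans (cong₂ _+_ (degree-layer n k x) (degree-layer n (suc k) x)) (nCk+nC[k+1]≡[n+1]C[k+1] n k))

-- Adjacent triples and triples with larger intersection

adjacency : Subset n → Subset n → ℕ
adjacency s t = indicator (adjacent? s t)

adjacency-comm : ∀ (s t : Subset n) → adjacency s t ≡ adjacency t s
adjacency-comm s t = cong (λ u → indicator (∣ u ∣ ≟ 1)) (∩-comm s t)

-- Each edge appears as two ordered pairs; the hypothesis removes the diagonal.
pairSum-edges : ∀ {W : List (Subset n)} → All (λ s → adjacency s s ≡ 0) W →
                pairSum adjacency W ≡ 2 * edges W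
pairSum-edges []                 = refl
pairSum-edges {W = s ∷ W} (p ∷ ps) = begin
  adjacency s s + d + ∑ (λ t → adjacency t s + ∑ (adjacency t) W) W
    ≡⟨ cong₂ (λ a b → a + d + b) p (∑-+ (λ t → adjacency t s) (λ t → ∑ (adjacency t) W) W) ⟩
  d + (∑ (λ t → adjacency t s) W + pairSum adjacency W)
    ≡⟨ cong₂ (λ a b → d + (a + b)) (∑-cong (λ t → adjacency-comm t s) W) (pairSum-edges ps) ⟩
  d + (d + 2 * edges W)
    ≡⟨ double d (edges W) ⟩
  2 * (d + edges W)
    ≡⟨ cong (λ a → 2 * (a + edges W)) (length-filter-∑ (adjacent? s) W) ⟨
  2 * edges (s ∷ W) ∎
  where
  open ≡-Reasoning
  d = ∑ (adjacency s) W
  double : ∀ d e → d + (d + 2 * e) ≡ 2 * (d + e)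
  double = solve-∀

adjacency-irrefl : ∀ (s : Subset n) → ∣ s ∣ ≡ 3 → adjacency s s ≡ 0
adjacency-irrefl s eq rewrite ∩-idem s | eq = refl

near : ℕ → Subset n → Subset n → ℕ
near j s t = indicator (j ≤? ∣ s ∩ t ∣)

adjacency-≤ : ∀ (s t : Subset n) → adjacency s t ≤ ∣ s ∩ t ∣
adjacency-≤ s t with ∣ s ∩ t ∣
... | 0           = z≤n
... | 1           = ≤-refl
... | suc (suc m) = z≤n

-- The intersection sizes 2 and 3 are not edges and are absorbed by the second term, whose factor 3
-- is the largest possible size.
∩-≤ : ∀ (s t : Subset n) → ∣ s ∣ ≡ 3 → ∣ s ∩ t ∣ ≤ adjacency s t + 3 * near 2 s t
∩-≤ s t eq with ∣ s ∩ t ∣ | ≤-trans (∣p∩q∣≤∣p∣ s t) (≤-reflexive eq)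
... | 0           | _ = z≤n
... | 1           | _ = ≤-refl
... | suc (suc m) | h = h

indicator-suc : ∀ j m → indicator (suc j ≤? suc m) ≡ indicator (j ≤? m)
indicator-suc zero    m = refl
indicator-suc (suc j) m = refl

indicator-no : ∀ {P : Set} (p : Dec P) → ¬ P → indicator p ≡ 0
indicator-no (yes p) ¬p = contradiction p ¬p
indicator-no (no _)  _  = refl

∑-near-zero : ∀ n k (s : Subset n) → ∑ (near 0 s) (layer n k) ≡ n C k
∑-near-zero n k s = trans (∑-const (All.universal (λ _ → refl) (layer n k)))
  (trans (*-identityʳ _) (length-layer n k))

-- A `j`-set sharing at least `j` points with `s` is a subset of `s`; the induction is Pascal's rule
-- for `∣ s ∣ C j`.
∑-near-layer : ∀ n j (s : Subset n) → ∑ (near j s) (layer n j) ≤ ∣ s ∣ C j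
∑-near-layer n       zero    s             = ≤-reflexive (∑-near-zero n 0 s)
∑-near-layer zero    (suc j) s             = z≤n
∑-near-layer (suc n) (suc j) (inside ∷ s)  = begin
  ∑ (near (suc j) (inside ∷ s)) (layer (suc n) (suc j))
    ≡⟨ ∑-layer n j (near (suc j) (inside ∷ s)) ⟩
  ∑ (λ t → indicator (suc j ≤? suc ∣ s ∩ t ∣)) (layer n j) + ∑ (near (suc j) s) (layer n (suc j))
    ≡⟨ cong (_+ ∑ (near (suc j) s) (layer n (suc j))) (∑-cong (λ t → indicator-suc j ∣ s ∩ t ∣) (layer n j)) ⟩
  ∑ (near j s) (layer n j) + ∑ (near (suc j) s) (layer n (suc j))
    ≤⟨ +-mono-≤ (∑-near-layer n j s) (∑-near-layer n (suc j) s) ⟩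
  ∣ s ∣ C j + ∣ s ∣ C suc j
    ≡⟨ nCk+nC[k+1]≡[n+1]C[k+1] ∣ s ∣ j ⟩
  suc ∣ s ∣ C suc j ∎
  where open ≤-Reasoning
∑-near-layer (suc n) (suc j) (outside ∷ s) = begin
  ∑ (near (suc j) (outside ∷ s)) (layer (suc n) (suc j))
    ≡⟨ ∑-layer n j (near (suc j) (outside ∷ s)) ⟩
  ∑ (near (suc j) s) (layer n j) + ∑ (near (suc j) s) (layer n (suc j))
    ≡⟨ cong (_+ ∑ (near (suc j) s) (layer n (suc j))) (∑-const far) ⟩
  length (layer n j) * 0 + ∑ (near (suc j) s) (layer n (suc j))
    ≡⟨ cong (_+ ∑ (near (suc j) s) (layer n (suc j))) (*-zeroʳ (length (layer n j))) ⟩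
  ∑ (near (suc j) s) (layer n (suc j))
    ≤⟨ ∑-near-layer n (suc j) s ⟩
  ∣ s ∣ C suc j ∎
  where
  open ≤-Reasoning
  far : All (λ t → near (suc j) s t ≡ 0) (layer n j)
  far = All.map (λ {t} ∣t∣≡j → indicator-no (suc j ≤? ∣ s ∩ t ∣)
    (<⇒≱ (s≤s (≤-trans (∣p∩q∣≤∣q∣ s t) (≤-reflexive ∣t∣≡j))))) (layer-sizes n j)

-- A `(j + 1)`-set sharing at least `j` points with `s` consists of `j` points of `s` and one more
-- of at most `n` points. When the first point lies outside `s`, it may serve as that extra point,
-- and the other `j` points are counted by `∑-near-layer`.
∑-near-layer-suc : ∀ n j (s : Subset n) → ∑ (near j s) (layer n (suc j)) ≤ (∣ s ∣ C j) * n
∑-near-layer-suc n       zero    s = ≤-reflexive (trans (∑-near-zero n 1 s) (trans (nC1≡n n) (sym (*-identityˡ n))))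
∑-near-layer-suc zero    (suc j) s = z≤n
∑-near-layer-suc (suc n) (suc j) (inside ∷ s)  = begin
  ∑ (near (suc j) (inside ∷ s)) (layer (suc n) (suc (suc j)))
    ≡⟨ ∑-layer n (suc j) (near (suc j) (inside ∷ s)) ⟩
  ∑ (λ t → indicator (suc j ≤? suc ∣ s ∩ t ∣)) (layer n (suc j)) + ∑ (near (suc j) s) (layer n (suc (suc j)))
    ≡⟨ cong (_+ ∑ (near (suc j) s) (layer n (suc (suc j)))) (∑-cong (λ t → indicator-suc j ∣ s ∩ t ∣) (layer n (suc j))) ⟩
  ∑ (near j s) (layer n (suc j)) + ∑ (near (suc j) s) (layer n (suc (suc j)))
    ≤⟨ +-mono-≤ (∑-near-layer-suc n j s) (∑-near-layer-suc n (suc j) s) ⟩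
  (∣ s ∣ C j) * n + (∣ s ∣ C suc j) * n
    ≡⟨ *-distribʳ-+ n (∣ s ∣ C j) (∣ s ∣ C suc j) ⟨
  (∣ s ∣ C j + ∣ s ∣ C suc j) * n
    ≡⟨ cong (_* n) (nCk+nC[k+1]≡[n+1]C[k+1] ∣ s ∣ j) ⟩
  (suc ∣ s ∣ C suc j) * n
    ≤⟨ *-monoʳ-≤ (suc ∣ s ∣ C suc j) (n≤1+n n) ⟩
  (suc ∣ s ∣ C suc j) * suc n ∎
  where open ≤-Reasoning
∑-near-layer-suc (suc n) (suc j) (outside ∷ s) = begin
  ∑ (near (suc j) (outside ∷ s)) (layer (suc n) (suc (suc j)))
    ≡⟨ ∑-layer n (suc j) (near (suc j) (outside ∷ s)) ⟩
  ∑ (near (suc j) s) (layer n (suc j)) + ∑ (near (suc j) s) (layer n (suc (suc j)))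
    ≤⟨ +-mono-≤ (∑-near-layer n (suc j) s) (∑-near-layer-suc n (suc j) s) ⟩
  ∣ s ∣ C suc j + (∣ s ∣ C suc j) * n
    ≡⟨ *-suc (∣ s ∣ C suc j) n ⟨
  (∣ s ∣ C suc j) * suc n ∎
  where open ≤-Reasoning

-- Edge counts by Cauchy-Schwarz

V-sizes : ∀ n → All (λ s → ∣ s ∣ ≡ 3) (V n)
V-sizes n = layer-sizes n 3

intersections-cauchy : ∀ {W : List (Subset n)} → All (λ s → ∣ s ∣ ≡ 3) W →
  (length W * 3) * (length W * 3) ≤ n * intersections W
intersections-cauchy {n} {W} ps = begin
  (length W * 3) * (length W * 3)
    ≡⟨ cong (λ a → a * a) (trans (sym (∑-const ps)) (sym (∑-degree W))) ⟩
  ∑ (degree W) (allFin n) * ∑ (degree W) (allFin n)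
    ≤⟨ cauchy-schwarz (degree W) (allFin n) ⟩
  length (allFin n) * ∑ (λ x → degree W x * degree W x) (allFin n)
    ≡⟨ cong₂ _*_ (length-tabulate {n = n} (λ x → x)) (sym (intersections-degree W)) ⟩
  n * intersections W ∎
  where open ≤-Reasoning

-- The error `9 * n` per member `s`: at most `(3 C 2) * n` triples, `s` itself included, share two
-- or more points with `s`, and each contributes at most 3.
intersections-≤ : ∀ {W : List (Subset n)} → W ⊆ V n →
  intersections W ≤ 2 * edges W + length W * (9 * n)
intersections-≤ {n} {W} W⊆V = begin
  ∑ (λ s → ∑ (λ t → ∣ s ∩ t ∣) W) W
    ≤⟨ ∑-mono (All.map (λ {s} eq → row s eq) sizes) ⟩
  ∑ (λ s → ∑ (adjacency s) W + 9 * n) W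
    ≡⟨ ∑-+ (λ s → ∑ (adjacency s) W) (λ _ → 9 * n) W ⟩
  pairSum adjacency W + ∑ (λ _ → 9 * n) W
    ≡⟨ cong₂ _+_ (pairSum-edges (All.map (λ {s} → adjacency-irrefl s) sizes))
                 (∑-const (All.universal (λ _ → refl) W)) ⟩
  2 * edges W + length W * (9 * n) ∎
  where
  open ≤-Reasoning
  sizes = All-resp-⊆ W⊆V (V-sizes n)
  row : ∀ s → ∣ s ∣ ≡ 3 → ∑ (λ t → ∣ s ∩ t ∣) W ≤ ∑ (adjacency s) W + 9 * n
  row s eq = begin
    ∑ (λ t → ∣ s ∩ t ∣) W
      ≤⟨ ∑-mono (All.universal (λ t → ∩-≤ s t eq) W) ⟩
    ∑ (λ t → adjacency s t + 3 * near 2 s t) W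
      ≡⟨ trans (∑-+ (adjacency s) _ W) (cong (∑ (adjacency s) W +_) (∑-*ˡ 3 (near 2 s) W)) ⟩
    ∑ (adjacency s) W + 3 * ∑ (near 2 s) W
      ≤⟨ +-monoʳ-≤ (∑ (adjacency s) W) (*-monoʳ-≤ 3 (≤-trans (∑-⊆ (near 2 s) W⊆V) (∑-near-layer-suc n 2 s))) ⟩
    ∑ (adjacency s) W + 3 * ((∣ s ∣ C 2) * n)
      ≡⟨ cong (λ k → ∑ (adjacency s) W + 3 * ((k C 2) * n)) eq ⟩
    ∑ (adjacency s) W + 3 * (3 * n)
      ≡⟨ cong (∑ (adjacency s) W +_) (sym (*-assoc 3 3 n)) ⟩
    ∑ (adjacency s) W + 9 * n ∎

-- Doubling the Cauchy-Schwarz bound gives a main term `18 L²` and an error `18 n² L`. The size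
-- hypothesis bounds the error by `9 L²`, so half of the main term survives.
edges-lower : ∀ {W : List (Subset n)} → W ⊆ V n → 2 * (n * n) ≤ length W →
  9 * (length W * length W) ≤ 4 * (n * edges W)
edges-lower {n} {W} W⊆V h = +-cancelʳ-≤ (9 * (L * L)) _ _ (begin
  9 * (L * L) + 9 * (L * L)                 ≡⟨ e₁ L ⟩
  2 * ((L * 3) * (L * 3))                   ≤⟨ *-monoʳ-≤ 2 (≤-trans (intersections-cauchy (All-resp-⊆ W⊆V (V-sizes n)))
                                                                    (*-monoʳ-≤ n (intersections-≤ W⊆V))) ⟩
  2 * (n * (2 * e + L * (9 * n)))           ≡⟨ e₂ n e L ⟩
  4 * (n * e) + 9 * (2 * (n * n) * L)       ≤⟨ +-monoʳ-≤ (4 * (n * e)) (*-monoʳ-≤ 9 (*-monoˡ-≤ L h)) ⟩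
  4 * (n * e) + 9 * (L * L)                 ∎)
  where
  open ≤-Reasoning
  L = length W
  e = edges W
  e₁ : ∀ L → 9 * (L * L) + 9 * (L * L) ≡ 2 * ((L * 3) * (L * 3))
  e₁ = solve-∀
  e₂ : ∀ n e L → 2 * (n * (2 * e + L * (9 * n))) ≡ 4 * (n * e) + 9 * (2 * (n * n) * L)
  e₂ = solve-∀

-- In `V n` all degrees equal `c`, so `intersections (V n)` is exactly `n * c²`; it dominates twice
-- the number of edges because an edge meets in one point.
edges-V : ∀ n → 2 * (n * edges (V n)) ≤ 9 * ((n C 3) * (n C 3))
edges-V zero      = z≤n
edges-V n@(suc m) = begin
  2 * (n * edges (V n))
    ≡⟨ e₁ n (edges (V n)) ⟩
  n * (2 * edges (V n))
    ≡⟨ cong (n *_) (pairSum-edges (All.map (λ {s} → adjacency-irrefl s) (V-sizes n))) ⟨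
  n * pairSum adjacency (V n)
    ≤⟨ *-monoʳ-≤ n (∑-mono (All.universal (λ s → ∑-mono (All.universal (adjacency-≤ s) (V n))) (V n))) ⟩
  n * intersections (V n)
    ≡⟨ cong (n *_) (intersections-degree (V n)) ⟩
  n * ∑ (λ x → degree (V n) x * degree (V n) x) (allFin n)
    ≡⟨ cong (n *_) (∑-const (All.universal (λ x → cong (λ a → a * a) (degree-layer m 2 x)) (allFin n))) ⟩
  n * (length (allFin n) * (c * c))
    ≡⟨ cong (λ k → n * (k * (c * c))) (length-tabulate {n = n} (λ x → x)) ⟩
  n * (n * (c * c))
    ≡⟨ e₂ n c ⟩
  (n * c) * (n * c)
    ≡⟨ cong (λ a → a * a) nc ⟩
  ((n C 3) * 3) * ((n C 3) * 3)
    ≡⟨ e₃ (n C 3) ⟩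
  9 * ((n C 3) * (n C 3)) ∎
  where
  open ≤-Reasoning
  c = m C 2
  e₁ : ∀ n e → 2 * (n * e) ≡ n * (2 * e)
  e₁ = solve-∀
  e₂ : ∀ n c → n * (n * (c * c)) ≡ (n * c) * (n * c)
  e₂ = solve-∀
  e₃ : ∀ N → (N * 3) * (N * 3) ≡ 9 * (N * N)
  e₃ = solve-∀
  -- Incidences between points and triples, counted from both sides.
  nc : n * c ≡ (n C 3) * 3
  nc = begin-equality
    n * c                          ≡⟨ cong (_* c) (length-tabulate {n = n} (λ x → x)) ⟨
    length (allFin n) * c          ≡⟨ ∑-const (All.universal (degree-layer m 2) (allFin n)) ⟨
    ∑ (degree (V n)) (allFin n)    ≡⟨ ∑-degree (V n) ⟩
    ∑ ∣_∣ (V n)                    ≡⟨ ∑-const (V-sizes n) ⟩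
    length (V n) * 3               ≡⟨ cong (_* 3) (length-layer n 3) ⟩
    (n C 3) * 3                    ∎

-- Thinning out a family

-- With the converse below, this lets the enumerations in `r` and `α` be treated as ranging over all
-- `W ⊆ V n`.
⊆⇒∈-sublists : ∀ {xs ys : List A} → xs ⊆ ys → xs ∈ sublists ys
⊆⇒∈-sublists []         = here refl
⊆⇒∈-sublists {ys = _ ∷ ys} (y ∷ʳ τ) = ∈-++⁺ʳ (map (y ∷_) (sublists ys)) (⊆⇒∈-sublists τ)
⊆⇒∈-sublists (refl ∷ τ) = ∈-++⁺ˡ (∈-map⁺ (_ ∷_) (⊆⇒∈-sublists τ))

∈-sublists⇒⊆ : ∀ {xs} (ys : List A) → xs ∈ sublists ys → xs ⊆ ys
∈-sublists⇒⊆ []       (here refl) = []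
∈-sublists⇒⊆ (y ∷ ys) p with ∈-++⁻ (map (y ∷_) (sublists ys)) p
... | inj₂ q = y ∷ʳ ∈-sublists⇒⊆ ys q
... | inj₁ q with ∈-map⁻ (y ∷_) q
...   | _ , q′ , refl = refl ∷ ∈-sublists⇒⊆ ys q′

AllPairs-resp-⊆ : ∀ {R : A → A → Set} {xs ys} → xs ⊆ ys → AllPairs R ys → AllPairs R xs
AllPairs-resp-⊆ []         []       = []
AllPairs-resp-⊆ (y ∷ʳ τ)   (_ ∷ ps) = AllPairs-resp-⊆ τ ps
AllPairs-resp-⊆ (refl ∷ τ) (p ∷ ps) = All-resp-⊆ τ p ∷ AllPairs-resp-⊆ τ ps

deletions : List A → List (List A)
deletions []       = []
deletions (x ∷ xs) = xs ∷ map (x ∷_) (deletions xs)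

length-deletions : ∀ (xs : List A) → length (deletions xs) ≡ length xs
length-deletions []       = refl
length-deletions (x ∷ xs) = cong suc (trans (length-map (x ∷_) (deletions xs)) (length-deletions xs))

deletions-⊆ : ∀ (xs : List A) → All (λ ys → ys ⊆ xs × suc (length ys) ≡ length xs) (deletions xs)
deletions-⊆ []       = []
deletions-⊆ (x ∷ xs) = (x ∷ʳ ⊆-refl , refl)
  ∷ All.map⁺ (All.map (λ (τ , eq) → refl ∷ τ , cong suc eq) (deletions-⊆ xs))

-- Every entry survives all deletions but one. The missing share is added on the left to avoid
-- truncated subtraction.
∑-deletions : ∀ (f : A → ℕ) xs → ∑ (∑ f) (deletions xs) + ∑ f xs ≡ length xs * ∑ f xs
∑-deletions f []       = refl
∑-deletions f (x ∷ xs) = begin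
  ∑ f xs + ∑ (∑ f) (map (x ∷_) (deletions xs)) + (f x + ∑ f xs)
    ≡⟨ cong (λ a → ∑ f xs + a + (f x + ∑ f xs)) eq ⟩
  ∑ f xs + (length xs * f x + D) + (f x + ∑ f xs)
    ≡⟨ rearrange (∑ f xs) (length xs) (f x) D ⟩
  suc (length xs) * f x + ∑ f xs + (D + ∑ f xs)
    ≡⟨ cong (suc (length xs) * f x + ∑ f xs +_) (∑-deletions f xs) ⟩
  suc (length xs) * f x + ∑ f xs + length xs * ∑ f xs
    ≡⟨ collect (length xs) (f x) (∑ f xs) ⟩
  suc (length xs) * (f x + ∑ f xs) ∎
  where
  open ≡-Reasoning
  D = ∑ (∑ f) (deletions xs)
  eq : ∑ (∑ f) (map (x ∷_) (deletions xs)) ≡ length xs * f x + D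
  eq = begin
    ∑ (∑ f) (map (x ∷_) (deletions xs))            ≡⟨ ∑-map (∑ f) (x ∷_) (deletions xs) ⟩
    ∑ (λ ys → f x + ∑ f ys) (deletions xs)         ≡⟨ ∑-+ (λ _ → f x) (∑ f) (deletions xs) ⟩
    ∑ (λ _ → f x) (deletions xs) + D               ≡⟨ cong (_+ D) (∑-const (All.universal (λ _ → refl) (deletions xs))) ⟩
    length (deletions xs) * f x + D                ≡⟨ cong (λ k → k * f x + D) (length-deletions xs) ⟩
    length xs * f x + D ∎
  rearrange : ∀ s k a d → s + (k * a + d) + (a + s) ≡ suc k * a + s + (d + s)
  rearrange = solve-∀
  collect : ∀ k a s → suc k * a + s + k * s ≡ suc k * (a + s)
  collect = solve-∀

-- An edge is lost in exactly two deletions, those of its endpoints.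
∑-edges-deletions : ∀ (W : List (Subset n)) → ∑ edges (deletions W) + 2 * edges W ≡ length W * edges W
∑-edges-deletions []      = refl
∑-edges-deletions (s ∷ W) = begin
  edges W + ∑ edges (map (s ∷_) (deletions W)) + 2 * (deg W + edges W)
    ≡⟨ cong (λ a → edges W + a + 2 * (deg W + edges W)) eq ⟩
  edges W + (P + D) + 2 * (deg W + edges W)
    ≡⟨ rearrange (edges W) P D (deg W) ⟩
  (P + deg W) + (D + 2 * edges W) + (deg W + edges W)
    ≡⟨ cong₂ (λ a b → a + b + (deg W + edges W)) degs (∑-edges-deletions W) ⟩
  length W * deg W + length W * edges W + (deg W + edges W)
    ≡⟨ collect (length W) (deg W) (edges W) ⟩
  suc (length W) * (deg W + edges W) ∎
  where
  open ≡-Reasoning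
  deg = λ U → length (filter (adjacent? s) U)
  P = ∑ deg (deletions W)
  D = ∑ edges (deletions W)
  eq : ∑ edges (map (s ∷_) (deletions W)) ≡ P + D
  eq = trans (∑-map edges (s ∷_) (deletions W)) (∑-+ deg edges (deletions W))
  degs : P + deg W ≡ length W * deg W
  degs = begin
    P + deg W
      ≡⟨ cong₂ _+_ (∑-cong (length-filter-∑ (adjacent? s)) (deletions W)) (length-filter-∑ (adjacent? s) W) ⟩
    ∑ (∑ (adjacency s)) (deletions W) + ∑ (adjacency s) W
      ≡⟨ ∑-deletions (adjacency s) W ⟩
    length W * ∑ (adjacency s) W
      ≡⟨ cong (length W *_) (length-filter-∑ (adjacent? s) W) ⟨
    length W * deg W ∎
  rearrange : ∀ e p d a → e + (p + d) + 2 * (a + e) ≡ (p + a) + (d + 2 * e) + (a + e)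
  rearrange = solve-∀
  collect : ∀ k a e → k * a + k * e + (a + e) ≡ suc k * (a + e)
  collect = solve-∀

∑-below-average : ∀ (f : A → ℕ) x xs → ∃[ y ] y ∈ x ∷ xs × suc (length xs) * f y ≤ ∑ f (x ∷ xs)
∑-below-average f x [] = x , here refl , ≤-refl
∑-below-average f x (x′ ∷ xs) with ∑-below-average f x′ xs
... | y , y∈ , h with ≤-total (f x) (f y)
...   | inj₁ fx≤fy = x , here refl , +-monoʳ-≤ (f x) (≤-trans (*-monoʳ-≤ (suc (length xs)) fx≤fy) h)
...   | inj₂ fy≤fx = y , there y∈ , +-mono-≤ fy≤fx h

-- The best single deletion does at least as well as the average one, which keeps a fraction
-- `1 - 2 / (m + 1)` of the edges.
edges-delete : ∀ {m} (W : List (Subset n)) → length W ≡ suc m →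
  ∃[ U ] U ⊆ W × length U ≡ m × suc m * edges U + 2 * edges W ≤ suc m * edges W
edges-delete W@(s ∷ W′) refl with ∑-below-average edges W′ (map (s ∷_) (deletions W′))
... | U , U∈ , h with All.lookup (deletions-⊆ W) U∈
...   | U⊆W , eq = U , U⊆W , suc-injective eq ,
  ≤-trans (+-monoˡ-≤ (2 * edges W) (subst (λ k → k * edges U ≤ ∑ edges (deletions W)) (length-deletions W) h))
          (≤-reflexive (∑-edges-deletions W))

-- Thinning never raises the edge density, the ratio of edges to ordered pairs: passing from `l + 1`
-- to `l` members keeps at most a fraction `(l - 1) / (l + 1)` of the edges, and this is the ratio
-- of `l (l - 1)` to `(l + 1) l`.
edges-thin : ∀ d l (W : List (Subset n)) → length W ≡ d + l →
  ∃[ U ] U ⊆ W × length U ≡ l × edges U * (length W * (length W ∸ 1)) ≤ edges W * (l * (l ∸ 1))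
edges-thin zero    l W refl = W , ⊆-refl , refl , ≤-refl
edges-thin (suc d) l W eq with edges-thin d (suc l) W (trans eq (sym (+-suc d l)))
... | U′ , U′⊆W , eq′ , h′ with edges-delete U′ eq′
-- The general case needs `l - 1`, so `l = 0` is settled by the empty family, which has no edges.
edges-thin (suc d) zero    W eq | U′ , U′⊆W , eq′ , h′ | [] , U⊆U′ , refl , h =
  [] , ⊆-trans U⊆U′ U′⊆W , refl , z≤n
edges-thin (suc d) (suc p) W eq | U′ , U′⊆W , eq′ , h′ | U , U⊆U′ , eq″ , h =
  U , ⊆-trans U⊆U′ U′⊆W , eq″ , *-cancelˡ-≤ (2 + p) (begin
    (2 + p) * (edges U * M)                    ≡⟨ *-assoc (2 + p) (edges U) M ⟨
    (2 + p) * edges U * M                      ≤⟨ *-monoˡ-≤ M step ⟩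
    p * edges U′ * M                           ≡⟨ *-assoc p (edges U′) M ⟩
    p * (edges U′ * M)                         ≤⟨ *-monoʳ-≤ p h′ ⟩
    p * (edges W * ((2 + p) * (1 + p)))        ≡⟨ rearrange p (edges W) ⟩
    (2 + p) * (edges W * ((1 + p) * p))        ∎)
  where
  open ≤-Reasoning
  M = length W * (length W ∸ 1)
  split : ∀ p e → (2 + p) * e ≡ p * e + 2 * e
  split = solve-∀
  step : (2 + p) * edges U ≤ p * edges U′
  step = +-cancelʳ-≤ (2 * edges U′) _ _ (≤-trans h (≤-reflexive (split p (edges U′))))
  rearrange : ∀ p e → p * (e * ((2 + p) * (1 + p))) ≡ (2 + p) * (e * ((1 + p) * p))
  rearrange = solve-∀

-- The independence number

_·_ : Vec Bool n → Vec Bool n → Bool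
[]      · []      = false
(a ∷ u) · (b ∷ v) = (a ∧ b) xor (u · v)

_⊕_ : Vec Bool n → Vec Bool n → Vec Bool n
_⊕_ = zipWith _xor_

·-distribʳ-⊕ : ∀ (u u′ v : Vec Bool n) → (u ⊕ u′) · v ≡ (u · v) xor (u′ · v)
·-distribʳ-⊕ []      []       []      = refl
·-distribʳ-⊕ (a ∷ u) (a′ ∷ u′) (b ∷ v) rewrite ·-distribʳ-⊕ u u′ v = lemma a a′ b (u · v) (u′ · v)
  where
  lemma : ∀ a a′ b x y → ((a xor a′) ∧ b) xor (x xor y) ≡ ((a ∧ b) xor x) xor ((a′ ∧ b) xor y)
  lemma false false b     x     y     = refl
  lemma false true  false x     y     = refl
  lemma false true  true  false y     = refl
  lemma false true  true  true  false = refl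
  lemma false true  true  true  true  = refl
  lemma true  false false x     y     = refl
  lemma true  false true  false y     = refl
  lemma true  false true  true  false = refl
  lemma true  false true  true  true  = refl
  lemma true  true  false x     y     = refl
  lemma true  true  true  false false = refl
  lemma true  true  true  false true  = refl
  lemma true  true  true  true  false = refl
  lemma true  true  true  true  true  = refl

-- The matrix of products of the `u`s with the `v`s over 𝔽₂ has ones on the diagonal and zeros above
-- it, hence full rank. Keeping `u` and `v` apart allows row operations on the `u`s alone.
Unitriangular : List (Vec Bool n × Vec Bool n) → Set
Unitriangular L = All (λ (u , v) → u · v ≡ true) L × AllPairs (λ (u , _) (_ , v) → u · v ≡ false) L

clear : Vec Bool n → Vec Bool (suc n) × Vec Bool (suc n) → Vec Bool n × Vec Bool n
clear w (a ∷ u , _ ∷ v) = (if a then u ⊕ w else u) , v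

clear-· : ∀ (w : Vec Bool n) p q → (true ∷ w) · proj₂ q ≡ false →
          proj₁ (clear w p) · proj₂ (clear w q) ≡ proj₁ p · proj₂ q
clear-· w (false ∷ u , _ ∷ _) (_ ∷ _ , b ∷ v) _ = refl
clear-· w (true ∷ u  , _ ∷ _) (_ ∷ _ , b ∷ v) h rewrite ·-distribʳ-⊕ u w v = lemma b (u · v) (w · v) h
  where
  lemma : ∀ b x y → b xor y ≡ false → x xor y ≡ b xor x
  lemma false x     false _ = xor-identityʳ x
  lemma true  false true  _ = refl
  lemma true  true  true  _ = refl

clear-unitriangular : ∀ (w : Vec Bool n) {L} → All (λ (_ , v) → (true ∷ w) · v ≡ false) L →
  Unitriangular L → Unitriangular (map (clear w) L)
clear-unitriangular w []       ([]     , [])     = [] , []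
clear-unitriangular w {p ∷ L} (h ∷ hs) (d ∷ ds , t ∷ ts) with clear-unitriangular w hs (ds , ts)
... | ds′ , ts′ = trans (clear-· w p p h) d ∷ ds′
                , All.map⁺ (All.zipWith (λ {q} (hq , tq) → trans (clear-· w p q hq) tq) (hs , t)) ∷ ts′

-- Clears the first coordinate of all u using the first u where it is 1, which
-- is dropped together with its partner; no earlier u is changed, so
-- unitriangularity survives.
eliminate : List (Vec Bool (suc n) × Vec Bool (suc n)) → List (Vec Bool n × Vec Bool n)
eliminate []                        = []
eliminate ((false ∷ u , _ ∷ v) ∷ L) = (u , v) ∷ eliminate L
eliminate ((true  ∷ u , _)     ∷ L) = map (clear u) L

length-eliminate : ∀ (L : List (Vec Bool (suc n) × Vec Bool (suc n))) → length L ≤ suc (length (eliminate L))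
length-eliminate []                        = z≤n
length-eliminate ((false ∷ u , _ ∷ v) ∷ L) = s≤s (length-eliminate L)
length-eliminate ((true  ∷ u , _)     ∷ L) = s≤s (≤-reflexive (sym (length-map (clear u) L)))

-- Each surviving second vector only loses its first coordinate, which `false ∷ u` ignores.
eliminate-orthogonal : ∀ (u : Vec Bool n) L → All (λ (_ , v) → (false ∷ u) · v ≡ false) L →
  All (λ (_ , v) → u · v ≡ false) (eliminate L)
eliminate-orthogonal u []                         []       = []
eliminate-orthogonal u ((false ∷ _ , _ ∷ _) ∷ L) (h ∷ hs) = h ∷ eliminate-orthogonal u L hs
eliminate-orthogonal u ((true  ∷ w , _ ∷ _) ∷ L) (_ ∷ hs) = All.map⁺ (All.map (λ { {_ ∷ _ , _ ∷ _} h → h }) hs)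

eliminate-unitriangular : ∀ (L : List (Vec Bool (suc n) × Vec Bool (suc n))) →
  Unitriangular L → Unitriangular (eliminate L)
eliminate-unitriangular []                        _                  = [] , []
eliminate-unitriangular ((false ∷ u , _ ∷ v) ∷ L) (d ∷ ds , t ∷ ts) with eliminate-unitriangular L (ds , ts)
... | ds′ , ts′ = d ∷ ds′ , eliminate-orthogonal u L t ∷ ts′
eliminate-unitriangular ((true ∷ u , _) ∷ L)      (d ∷ ds , t ∷ ts) = clear-unitriangular u t (ds , ts)

-- Each elimination lowers the dimension by one and costs at most one pair. In dimension 0 all
-- products vanish, so no diagonal entry can be 1.
unitriangular-length : ∀ n (L : List (Vec Bool n × Vec Bool n)) → Unitriangular L → length L ≤ n
unitriangular-length zero    []              _            = z≤n
unitriangular-length zero    (([] , []) ∷ _) (() ∷ _ , _)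
unitriangular-length (suc n) L               tri          =
  ≤-trans (length-eliminate L) (s≤s (unitriangular-length n (eliminate L) (eliminate-unitriangular L tri)))

-- Parity of intersections and the bounds on `α`

odd : ℕ → Bool
odd zero    = false
odd (suc m) = not (odd m)

·-odd : ∀ (s t : Subset n) → s · t ≡ odd ∣ s ∩ t ∣
·-odd []            []            = refl
·-odd (inside ∷ s)  (inside ∷ t)  = cong not (·-odd s t)
·-odd (inside ∷ s)  (outside ∷ t) = ·-odd s t
·-odd (outside ∷ s) (_ ∷ t)       = ·-odd s t

∣∩∣-full : ∀ (s t : Subset n) → ∣ s ∩ t ∣ ≡ ∣ s ∣ → ∣ s ∩ t ∣ ≡ ∣ t ∣ → s ≡ t
∣∩∣-full []            []            _ _ = refl
∣∩∣-full (inside ∷ s)  (inside ∷ t)  p q = cong (inside ∷_) (∣∩∣-full s t (suc-injective p) (suc-injective q))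
∣∩∣-full (inside ∷ s)  (outside ∷ t) p q = contradiction (∣p∩q∣≤∣p∣ s t) (<⇒≱ (≤-reflexive (sym p)))
∣∩∣-full (outside ∷ s) (inside ∷ t)  p q = contradiction (∣p∩q∣≤∣q∣ s t) (<⇒≱ (≤-reflexive (sym q)))
∣∩∣-full (outside ∷ s) (outside ∷ t) p q = cong (outside ∷_) (∣∩∣-full s t p q)

-- Of the sizes 0 to 3, non-adjacency excludes 1 and distinctness excludes 3.
nonadjacent-even : ∀ (s t : Subset n) → ∣ s ∣ ≡ 3 → ∣ t ∣ ≡ 3 → s ≢ t → ¬ Adjacent s t → odd ∣ s ∩ t ∣ ≡ false
nonadjacent-even s t ∣s∣ ∣t∣ s≢t ¬adj
  with ∣ s ∩ t ∣ in eq | ≤-trans (∣p∩q∣≤∣p∣ s t) (≤-reflexive ∣s∣)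
... | 0 | _ = refl
... | 1 | _ = contradiction refl ¬adj
... | 2 | _ = refl
... | 3 | _ = contradiction (∣∩∣-full s t (trans eq (sym ∣s∣)) (trans eq (sym ∣t∣))) s≢t
... | suc (suc (suc (suc _))) | s≤s (s≤s (s≤s ()))

allSubsets-unique : ∀ n → Unique (allSubsets n)
allSubsets-unique zero    = [] ∷ []
allSubsets-unique (suc n) = Unique.++⁺ (Unique.map⁺ ∷-injectiveʳ (allSubsets-unique n))
  (Unique.map⁺ ∷-injectiveʳ (allSubsets-unique n)) disjoint
  where
  disjoint : ∀ {s} → s ∈ map (inside ∷_) (allSubsets n) × s ∈ map (outside ∷_) (allSubsets n) → ⊥
  disjoint (p , q) with ∈-map⁻ (inside ∷_) p | ∈-map⁻ (outside ∷_) q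
  ... | _ , _ , refl | _ , _ , ()

V-unique : ∀ n → Unique (V n)
V-unique n = Unique.filter⁺ (λ s → ∣ s ∣ ≟ 3) (allSubsets-unique n)

-- Pairing each characteristic vector with itself yields the Gram matrix mod 2, which is the
-- identity: 3 is odd and all other intersections are even.
independent-unitriangular : ∀ {W : List (Subset n)} → All (λ s → ∣ s ∣ ≡ 3) W → Unique W → Independent W →
  Unitriangular (map (λ s → s , s) W)
independent-unitriangular [] [] [] = [] , []
independent-unitriangular {W = s ∷ W} (z ∷ zs) (u ∷ us) (i ∷ is) with independent-unitriangular zs us is
... | ds , ts =
    trans (·-odd s s) (trans (cong (odd ∘ ∣_∣) (∩-idem s)) (cong odd z)) ∷ ds
  , All.map⁺ (All.zipWith (λ {t} (∣t∣ , s≢t , ¬adj) →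
      trans (·-odd s t) (nonadjacent-even s t z ∣t∣ s≢t ¬adj)) (zs , All.zip (u , i))) ∷ ts

α-upper : ∀ n → α n ≤ n
α-upper n = max≤v⁺ z≤n (All.map⁺ (All.tabulate bound))
  where
  bound : ∀ {W} → W ∈ filter independent? (sublists (V n)) → length W ≤ n
  bound {W} W∈ with ∈-filter⁻ independent? {xs = sublists (V n)} W∈
  ... | W∈V , indep with ∈-sublists⇒⊆ (V n) W∈V
  ...   | W⊆V = subst (_≤ n) (length-map (λ s → s , s) W) (unitriangular-length n _
    (independent-unitriangular (All-resp-⊆ W⊆V (V-sizes n)) (AllPairs-resp-⊆ W⊆V (V-unique n)) indep))

layer-suc-⊆ : ∀ n k → map (inside ∷_) (layer n k) ⊆ layer (suc n) (suc k)
layer-suc-⊆ n k = subst (map (inside ∷_) (layer n k) ⊆_) (sym (layer-suc n k))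
  (++⁺ʳ (map (outside ∷_) (layer n (suc k))) ⊆-refl)

α-lower : ∀ n → n ≤ 2 + α n
α-lower zero          = z≤n
α-lower (suc zero)    = s≤s z≤n
α-lower (suc (suc m)) = s≤s (s≤s (v≤max⁺ 0 _ (inj₂ (Any.map⁺ (lose W∈ (≤-reflexive (sym ∣W∣)))))))
  where
  -- The triples through the first two points. Any two of them share at least these points, so their
  -- intersection never has size 1.
  W = map (inside ∷_) (map (inside ∷_) (layer m 1))
  ∣W∣ : length W ≡ m
  ∣W∣ = trans (length-map (inside ∷_) (map (inside ∷_) (layer m 1)))
    (trans (length-map (inside ∷_) (layer m 1)) (trans (length-layer m 1) (nC1≡n m)))
  W-independent : Independent W
  W-independent = AllPairs.map⁺ (AllPairs.map⁺ (universal (layer m 1)))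
    where
    universal : ∀ xs → AllPairs (λ s t → ¬ Adjacent (inside ∷ inside ∷ s) (inside ∷ inside ∷ t)) xs
    universal []       = []
    universal (x ∷ xs) = All.universal (λ _ ()) xs ∷ universal xs
  W∈ : W ∈ filter independent? (sublists (V (suc (suc m))))
  W∈ = ∈-filter⁺ independent?
    (⊆⇒∈-sublists (⊆-trans (⊆-map⁺ (inside ∷_) (layer-suc-⊆ m 1)) (layer-suc-⊆ (suc m) 2)))
    W-independent

-- Bounds on r

2*[1+n]C2 : ∀ n → 2 * (suc n C 2) ≡ n * suc n
2*[1+n]C2 zero    = refl
2*[1+n]C2 (suc n) = begin
  2 * (suc (suc n) C 2)             ≡⟨ cong (2 *_) (nCk+nC[k+1]≡[n+1]C[k+1] (suc n) 1) ⟨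
  2 * (suc n C 1 + suc n C 2)       ≡⟨ *-distribˡ-+ 2 (suc n C 1) (suc n C 2) ⟩
  2 * (suc n C 1) + 2 * (suc n C 2) ≡⟨ cong₂ (λ a b → 2 * a + b) (nC1≡n (suc n)) (2*[1+n]C2 n) ⟩
  2 * suc n + n * suc n             ≡⟨ e n ⟩
  suc n * suc (suc n)               ∎
  where
  open ≡-Reasoning
  e : ∀ n → 2 * suc n + n * suc n ≡ suc n * suc (suc n)
  e = solve-∀

6*[2+n]C3 : ∀ n → 6 * ((2 + n) C 3) ≡ n * (1 + n) * (2 + n)
6*[2+n]C3 zero    = refl
6*[2+n]C3 (suc n) = begin
  6 * ((3 + n) C 3)                         ≡⟨ cong (6 *_) (nCk+nC[k+1]≡[n+1]C[k+1] (2 + n) 2) ⟨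
  6 * ((2 + n) C 2 + (2 + n) C 3)           ≡⟨ e₁ ((2 + n) C 2) ((2 + n) C 3) ⟩
  3 * (2 * ((2 + n) C 2)) + 6 * ((2 + n) C 3) ≡⟨ cong₂ (λ a b → 3 * a + b) (2*[1+n]C2 (suc n)) (6*[2+n]C3 n) ⟩
  3 * ((1 + n) * (2 + n)) + n * (1 + n) * (2 + n) ≡⟨ e₂ n ⟩
  (1 + n) * (2 + n) * (3 + n)               ∎
  where
  open ≡-Reasoning
  e₁ : ∀ a b → 6 * (a + b) ≡ 3 * (2 * a) + 6 * b
  e₁ = solve-∀
  e₂ : ∀ n → 3 * ((1 + n) * (2 + n)) + n * (1 + n) * (2 + n) ≡ (1 + n) * (2 + n) * (3 + n)
  e₂ = solve-∀

-- The constant is tight at `n = 4`. Substituting `n = 4 + m` leaves a difference with non-negative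
-- coefficients.
n³≤16*nC3 : ∀ n → 4 ≤ n → n * (n * n) ≤ 16 * (n C 3)
n³≤16*nC3 n 4≤n = subst (λ k → k * (k * k) ≤ 16 * (k C 3)) (m+[n∸m]≡n 4≤n) (bound (n ∸ 4))
  where
  open ≤-Reasoning
  e₁ : ∀ m → 3 * ((4 + m) * ((4 + m) * (4 + m))) + (5 * (m * m) + 16 * m) * (4 + m) ≡ 8 * ((2 + m) * (3 + m) * (4 + m))
  e₁ = solve-∀
  e₂ : ∀ x → 8 * (6 * x) ≡ 3 * (16 * x)
  e₂ = solve-∀
  bound : ∀ m → (4 + m) * ((4 + m) * (4 + m)) ≤ 16 * ((4 + m) C 3)
  bound m = *-cancelˡ-≤ 3 (begin
    3 * ((4 + m) * ((4 + m) * (4 + m)))      ≤⟨ m≤m+n _ ((5 * (m * m) + 16 * m) * (4 + m)) ⟩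
    3 * ((4 + m) * ((4 + m) * (4 + m))) + (5 * (m * m) + 16 * m) * (4 + m) ≡⟨ e₁ m ⟩
    8 * ((2 + m) * (3 + m) * (4 + m))        ≡⟨ cong (8 *_) (6*[2+n]C3 (2 + m)) ⟨
    8 * (6 * ((4 + m) C 3))                  ≡⟨ e₂ ((4 + m) C 3) ⟩
    3 * (16 * ((4 + m) C 3))                 ∎)

10≤nC3 : ∀ n → 6 ≤ n → 10 ≤ n C 3
10≤nC3 n 6≤n = *-cancelˡ-≤ 16 (begin
  160          ≤⟨ m≤m+n 160 56 ⟩
  6 * (6 * 6)  ≤⟨ *-mono-≤ 6≤n (*-mono-≤ 6≤n 6≤n) ⟩
  n * (n * n)  ≤⟨ n³≤16*nC3 n (≤-trans (m≤m+n 4 2) 6≤n) ⟩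
  16 * (n C 3) ∎)
  where open ≤-Reasoning

r-≤-edges : ∀ n {W : List (Subset n)} → W ⊆ V n → r n (length W) ≤ edges W
r-≤-edges n {W} W⊆V = min≤v⁺ (edges (V n)) _
  (inj₂ (Any.map⁺ (lose (∈-filter⁺ (λ U → length U ≟ length W) (⊆⇒∈-sublists W⊆V) refl) ≤-refl)))

-- `r n l` is either the edge count of an enumerated family or the default `edges (V n)`. Asking for
-- `l ≤ length W` instead of equality covers both at once.
r-all : ∀ n l {P : ℕ → Set} → l ≤ n C 3 → (∀ {W} → W ⊆ V n → l ≤ length W → P (edges W)) → P (r n l)
r-all n l {P} l≤ h = argmin-all id {P = P}
  (h ⊆-refl (≤-trans l≤ (≤-reflexive (sym (length-layer n 3)))))
  (All.map⁺ (All.tabulate each))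
  where
  each : ∀ {W} → W ∈ filter (λ U → length U ≟ l) (sublists (V n)) → P (edges W)
  each W∈ with ∈-filter⁻ (λ U → length U ≟ l) {xs = sublists (V n)} W∈
  ... | W∈V , eq = h (∈-sublists⇒⊆ (V n) W∈V) (≤-reflexive (sym eq))

n≤2α : ∀ n → 4 ≤ n → n ≤ 2 * α n
n≤2α n 4≤n = +-cancelʳ-≤ 4 _ _ (begin
  n + 4             ≤⟨ +-monoʳ-≤ n 4≤n ⟩
  n + n             ≤⟨ +-mono-≤ (α-lower n) (α-lower n) ⟩
  2 + α n + (2 + α n) ≡⟨ e (α n) ⟩
  2 * α n + 4       ∎)
  where
  open ≤-Reasoning
  e : ∀ a → 2 + a + (2 + a) ≡ 2 * a + 4
  e = solve-∀

-- Replacing `n` by `2 * α n` in `edges-lower` weakens its constant 9/4 to 9/8, which is still above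
-- 1.
r-lower : ∀ n l → 4 ≤ n → 2 * (n * n) ≤ l → l ≤ n C 3 → l * l ≤ r n l * α n
r-lower n l 4≤n h l≤ = r-all n l {λ e → l * l ≤ e * α n} l≤ bound
  where
  open ≤-Reasoning
  e₁ : ∀ e a → 4 * (2 * a * e) ≡ 8 * (e * a)
  e₁ = solve-∀
  bound : ∀ {W} → W ⊆ V n → l ≤ length W → l * l ≤ edges W * α n
  bound {W} W⊆V l≤W = *-cancelˡ-≤ 8 (begin
    8 * (l * l)                ≤⟨ *-mono-≤ (n≤1+n 8) (*-mono-≤ l≤W l≤W) ⟩
    9 * (length W * length W)  ≤⟨ edges-lower W⊆V (≤-trans h l≤W) ⟩
    4 * (n * edges W)          ≤⟨ *-monoʳ-≤ 4 (*-monoˡ-≤ (edges W) (n≤2α n 4≤n)) ⟩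
    4 * (2 * α n * edges W)    ≡⟨ e₁ (edges W) (α n) ⟩
    8 * (edges W * α n)        ∎)

-- The two bounds combine to `e * n` at most `(9/2) l² N / (N - 1)`. For `N` at least 10 the last
-- quotient is at most 10/9, and `(9/2) (10/9) = 5`.
averaging : ∀ {n e E N l} → e * (N * (N ∸ 1)) ≤ E * (l * (l ∸ 1)) →
  2 * (n * E) ≤ 9 * (N * N) → 10 ≤ N → e * n ≤ 5 * (l * l)
averaging {n} {e} {E} {suc M} {l} h₁ h₂ (s≤s 9≤M) = *-cancelˡ-≤ (2 * (N * M)) {{>-nonZero positive}} (begin
  2 * (N * M) * (e * n)      ≡⟨ e₁ (N * M) e n ⟩
  2 * n * (e * (N * M))      ≤⟨ *-monoʳ-≤ (2 * n) h₁ ⟩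
  2 * n * (E * (l * (l ∸ 1))) ≤⟨ *-monoʳ-≤ (2 * n) (*-monoʳ-≤ E (*-monoʳ-≤ l (m∸n≤m l 1))) ⟩
  2 * n * (E * (l * l))      ≡⟨ e₂ n E (l * l) ⟩
  2 * (n * E) * (l * l)      ≤⟨ *-monoˡ-≤ (l * l) h₂ ⟩
  9 * (N * N) * (l * l)      ≤⟨ *-monoˡ-≤ (l * l) 9N²≤10NM ⟩
  10 * (N * M) * (l * l)     ≡⟨ e₃ (N * M) (l * l) ⟩
  2 * (N * M) * (5 * (l * l)) ∎)
  where
  open ≤-Reasoning
  N = suc M
  positive : 0 < 2 * (N * M)
  positive = *-mono-≤ {1} {2} (s≤s z≤n) (*-mono-≤ {1} {N} (s≤s z≤n) (≤-trans (s≤s z≤n) 9≤M))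
  e₀ : ∀ N → 9 * (N * N) ≡ N * (9 * N)
  e₀ = solve-∀
  e₀′ : ∀ N M → N * (10 * M) ≡ 10 * (N * M)
  e₀′ = solve-∀
  9N²≤10NM : 9 * (N * N) ≤ 10 * (N * M)
  9N²≤10NM = begin
    9 * (N * N)      ≡⟨ e₀ N ⟩
    N * (9 * N)      ≡⟨ cong (N *_) (*-suc 9 M) ⟩
    N * (9 + 9 * M)  ≤⟨ *-monoʳ-≤ N (+-monoˡ-≤ (9 * M) 9≤M) ⟩
    N * (10 * M)     ≡⟨ e₀′ N M ⟩
    10 * (N * M)     ∎
  e₁ : ∀ k e n → 2 * k * (e * n) ≡ 2 * n * (e * k)
  e₁ = solve-∀
  e₂ : ∀ n E k → 2 * n * (E * k) ≡ 2 * (n * E) * k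
  e₂ = solve-∀
  e₃ : ∀ k j → 10 * k * j ≡ 2 * k * (5 * j)
  e₃ = solve-∀

r-upper : ∀ n l → 6 ≤ n → l ≤ n C 3 → r n l * α n ≤ 5 * (l * l)
r-upper n l 6≤n l≤ with edges-thin (n C 3 ∸ l) l (V n) (trans (length-layer n 3) (sym (m∸n+n≡m l≤)))
... | W , W⊆V , refl , h = ≤-trans (*-mono-≤ (r-≤-edges n W⊆V) (α-upper n))
  (averaging {n} {edges W} {edges (V n)} {n C 3} {length W}
    (subst (λ N → edges W * (N * (N ∸ 1)) ≤ edges (V n) * (length W * (length W ∸ 1))) (length-layer n 3) h)
    (edges-V n) (10≤nC3 n 6≤n))

-- Asymptotics

open import Data.Integer.Base as ℤ using (+_; +[1+_]; +≤+; +<+)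

o⇒eventually : ∀ {a b : ℕ → ℕ} → (λ n → fromℕ (a n)) =o (λ n → fromℕ (b n)) →
  ∀ k → Eventually (λ n → suc k * a n ≤ b n)
-- Take `ε = 1 / (k + 1)` and clear denominators.
o⇒eventually {a} {b} a=ob k with a=ob (+ 1 ℚ./ suc k) (*<* (+<+ (s≤s z≤n)))
... | N , h = N , λ n N≤n → bound (a n) (b n) (h n N≤n)
  where
  bound : ∀ x y → ℚ.∣ fromℕ x ∣ ℚ.≤ (+ 1 ℚ./ suc k) ℚ.* ℚ.∣ fromℕ y ∣ → suc k * x ≤ y
  bound x y (*≤* p) = begin
    suc k * x        ≡⟨ e₁ (suc k) x ⟩
    x * (suc k * 1)  ≤⟨ ℤ.drop‿+≤+ (subst₂ ℤ._≤_ (sym (ℤ.pos-* x (suc k * 1))) eq p) ⟩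
    1 * y * 1        ≡⟨ e₂ y ⟩
    y                ∎
    where
    open ≤-Reasoning
    e₁ : ∀ k x → k * x ≡ x * (k * 1)
    e₁ = solve-∀
    e₂ : ∀ y → 1 * y * 1 ≡ y
    e₂ = solve-∀
    eq : (+ 1 ℤ.* + y) ℤ.* + 1 ≡ + (1 * y * 1)
    eq = trans (cong (ℤ._* + 1) (sym (ℤ.pos-* 1 y))) (sym (ℤ.pos-* (1 * y) 1))

÷-≤-fromℕ : ∀ {m a k} → m ≤ k * a → (m ÷ a) ℚ.≤ fromℕ k
÷-≤-fromℕ {m} {zero}  {k} _ = *≤* (subst (+ 0 ℤ.≤_) (ℤ.pos-* k 1) (+≤+ z≤n))
÷-≤-fromℕ {m} {suc a} {k} h = *≤* (subst₂ ℤ._≤_ (ℤ.pos-* m 1) (ℤ.pos-* k (suc a))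
  (+≤+ (≤-trans (≤-reflexive (*-identityʳ m)) h)))

floor : ℕ → ℕ → ℕ
floor m zero    = 0
floor m (suc d) = m / suc d

≤-floor : ∀ {k m} a → 0 < a → k * a ≤ m → k ≤ floor m a
≤-floor {k} (suc a) _ h = ≤-trans (≤-reflexive (sym (m*n/n≡m k (suc a)))) (/-monoˡ-≤ (suc a) h)

-- The left side is the absolute numerator that unnormalised subtraction yields for the rounded
-- minus the exact quotient.
∣floor-÷∣ : ∀ X a → ℤ.∣ + (X / suc a) ℤ.* + suc a ℤ.+ (ℤ.- + X) ℤ.* + 1 ∣ ≡ X % suc a
∣floor-÷∣ X a = begin
  ℤ.∣ + q ℤ.* + suc a ℤ.+ (ℤ.- + X) ℤ.* + 1 ∣
    ≡⟨ cong₂ (λ x y → ℤ.∣ x ℤ.+ y ∣) (sym (ℤ.pos-* q (suc a))) (ℤ.*-identityʳ (ℤ.- + X)) ⟩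
  ℤ.∣ + (q * suc a) ℤ.- + X ∣
    ≡⟨ ℤ.∣i-j∣≡∣j-i∣ (+ (q * suc a)) (+ X) ⟩
  ℤ.∣ + X ℤ.- + (q * suc a) ∣
    ≡⟨ cong (λ x → ℤ.∣ + x ℤ.- + (q * suc a) ∣) (m≡m%n+[m/n]*n X (suc a)) ⟩
  ℤ.∣ + (X % suc a + q * suc a) ℤ.- + (q * suc a) ∣
    ≡⟨ cong ℤ.∣_∣ (trans (ℤ.m-n≡m⊖n (X % suc a + q * suc a) (q * suc a)) (ℤ.⊖-≥ (m≤n+m (q * suc a) (X % suc a)))) ⟩
  X % suc a + q * suc a ∸ q * suc a
    ≡⟨ m+n∸n≡m (X % suc a) (q * suc a) ⟩
  X % suc a ∎
  where
  open ≡-Reasoning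
  q = X / suc a

-- Rounding costs less than 1, whereas the tolerance is at least `1 / (d + 1)` times a quotient of
-- at least `d + 1`.
floor-close : ∀ {X a} p d → 0 < a → a * suc d ≤ X →
  ℚ.∣ fromℕ (floor X a) ℚ.- (X ÷ a) ∣ ℚ.≤ mkℚᵘ +[1+ p ] d ℚ.* ℚ.∣ X ÷ a ∣
floor-close {X} {suc a} p d _ h = *≤* (subst₂ ℤ._≤_ eqˡ eqʳ (+≤+ (begin
  (X % suc a) * (suc d * suc a)   ≡⟨ *-assoc (X % suc a) (suc d) (suc a) ⟨
  (X % suc a) * suc d * suc a     ≤⟨ *-monoˡ-≤ (suc a) (*-monoˡ-≤ (suc d) (<⇒≤ (m%n<n X (suc a)))) ⟩
  suc a * suc d * suc a           ≤⟨ *-monoˡ-≤ (suc a) (≤-trans h (m≤n*m X (suc p))) ⟩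
  suc p * X * suc a               ≡⟨ cong (suc p * X *_) (*-identityˡ (suc a)) ⟨
  suc p * X * (1 * suc a)         ∎)))
  where
  open ≤-Reasoning
  eqˡ : + ((X % suc a) * (suc d * suc a)) ≡ + ℤ.∣ + (X / suc a) ℤ.* + suc a ℤ.+ (ℤ.- + X) ℤ.* + 1 ∣ ℤ.* + (suc d * suc a)
  eqˡ = trans (ℤ.pos-* (X % suc a) (suc d * suc a))
    (cong (λ m → + m ℤ.* + (suc d * suc a)) (sym (∣floor-÷∣ X a)))
  eqʳ : + (suc p * X * (1 * suc a)) ≡ (+ suc p ℤ.* + X) ℤ.* + (1 * suc a)
  eqʳ = trans (ℤ.pos-* (suc p * X) (1 * suc a)) (cong (ℤ._* + (1 * suc a)) (ℤ.pos-* (suc p) X))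

-- The growth conditions say nothing about small `n`: for `n = 3` and `l n = 1` the lower bound
-- would read 1 ≤ 0, so it is claimed eventually, together with `l n ≤ n C 3`, which makes
-- `r n (l n)` meaningful.
theorem1 : (f g l : ℕ → ℕ) →
    (λ n → fromℕ (n ^ 2)) =o (λ n → fromℕ (f n)) →
    (λ n → fromℕ (g n)) =o (λ n → fromℕ (n ^ 3)) →
    (∀ n → f n ≤ l n × l n ≤ g n) →
    Σ[ h ∈ (ℕ → ℕ) ] ( (λ n → fromℕ (h n)) ∼ (λ n → (5 * l n ^ 2) ÷ α n)
    × (∀ n → l n ≤ n C 3 → r n (l n) ≤ h n)
    × Eventually (λ n → l n ≤ n C 3 × (l n ^ 2) ÷ α n ℚ.≤ fromℕ (r n (l n))) )
theorem1 f g l n²=of g=on³ bounds = h , h∼ , (λ n _ → m≤m⊔n _ _) , N , lower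
  where
  X : ℕ → ℕ
  X n = 5 * l n ^ 2

  h : ℕ → ℕ
  -- The maximum secures the upper bound at every `n`; by `r-upper` it eventually equals the rounded
  -- quotient, which gives the asymptotics.
  h n = r n (l n) ⊔ floor (X n) (α n)

  square : ∀ m → m ^ 2 ≡ m * m
  square m = cong (m *_) (*-identityʳ m)

  -- The index 1 yields `2 * n ^ 2 ≤ f n`, as `edges-lower` requires; the index 15 yields
  -- `16 * g n ≤ n ^ 3`, matching `n³≤16*nC3`.
  N₁,f-large = o⇒eventually n²=of 1
  N₂,g-small = o⇒eventually g=on³ 15
  N₁ = proj₁ N₁,f-large
  N₂ = proj₁ N₂,g-small
  N = 6 + (N₁ + N₂)

  6≤ : ∀ {n} → N ≤ n → 6 ≤ n
  6≤ N≤n = ≤-trans (m≤m+n 6 (N₁ + N₂)) N≤n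

  l-large : ∀ n → N ≤ n → 2 * (n * n) ≤ l n
  l-large n N≤n = begin
    2 * (n * n) ≡⟨ cong (2 *_) (square n) ⟨
    2 * n ^ 2   ≤⟨ proj₂ N₁,f-large n (≤-trans (≤-trans (m≤m+n N₁ N₂) (m≤n+m (N₁ + N₂) 6)) N≤n) ⟩
    f n         ≤⟨ proj₁ (bounds n) ⟩
    l n         ∎
    where open ≤-Reasoning

  l-small : ∀ n → N ≤ n → l n ≤ n C 3
  l-small n N≤n = *-cancelˡ-≤ 16 (begin
    16 * l n     ≤⟨ *-monoʳ-≤ 16 (proj₂ (bounds n)) ⟩
    16 * g n     ≤⟨ proj₂ N₂,g-small n (≤-trans (≤-trans (m≤n+m N₂ N₁) (m≤n+m (N₁ + N₂) 6)) N≤n) ⟩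
    n ^ 3        ≡⟨ cong (n *_) (square n) ⟩
    n * (n * n)  ≤⟨ n³≤16*nC3 n (≤-trans (m≤m+n 4 2) (6≤ N≤n)) ⟩
    16 * (n C 3) ∎)
    where open ≤-Reasoning

  lower : ∀ n → N ≤ n → l n ≤ n C 3 × (l n ^ 2) ÷ α n ℚ.≤ fromℕ (r n (l n))
  lower n N≤n = l-small n N≤n , ÷-≤-fromℕ (≤-trans (≤-reflexive (square (l n)))
    (r-lower n (l n) (≤-trans (m≤m+n 4 2) (6≤ N≤n)) (l-large n N≤n) (l-small n N≤n)))

  α-positive : ∀ n → N ≤ n → 0 < α n
  α-positive n N≤n = +-cancelˡ-< 2 0 (α n) (≤-trans (≤-trans (m≤m+n 3 3) (6≤ N≤n)) (α-lower n))

  h-eventually : ∀ n → N ≤ n → h n ≡ floor (X n) (α n)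
  h-eventually n N≤n = m≤n⇒m⊔n≡n (≤-floor (α n) (α-positive n N≤n)
    (≤-trans (r-upper n (l n) (6≤ N≤n) (l-small n N≤n)) (≤-reflexive (cong (5 *_) (sym (square (l n)))))))

  X-large : ∀ n d → N ≤ n → d ≤ n → α n * d ≤ X n
  X-large n d N≤n d≤n = begin
    α n * d        ≤⟨ *-mono-≤ (α-upper n) d≤n ⟩
    n * n          ≤⟨ m≤n*m (n * n) 2 ⟩
    2 * (n * n)    ≤⟨ l-large n N≤n ⟩
    l n            ≤⟨ m≤m*m (l n) ⟩
    l n * l n      ≡⟨ square (l n) ⟨
    l n ^ 2        ≤⟨ m≤n*m (l n ^ 2) 5 ⟩
    5 * l n ^ 2    ∎
    where
    open ≤-Reasoning
    m≤m*m : ∀ m → m ≤ m * m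
    m≤m*m zero      = z≤n
    m≤m*m m@(suc _) = m≤m*n m m

  h∼ : (λ n → fromℕ (h n)) ∼ (λ n → X n ÷ α n)
  -- Beyond `N + suc d` also `suc d ≤ n`, so `X n ÷ α n` is at least the denominator of the
  -- tolerance.
  h∼ (mkℚᵘ +[1+ p ] d) _ = N + suc d , λ n N+d≤n →
    let N≤n = ≤-trans (m≤m+n N (suc d)) N+d≤n in
    subst (λ k → ℚ.∣ fromℕ k ℚ.- (X n ÷ α n) ∣ ℚ.≤ mkℚᵘ +[1+ p ] d ℚ.* ℚ.∣ X n ÷ α n ∣) (sym (h-eventually n N≤n))
      (floor-close p d (α-positive n N≤n) (X-large n (suc d) N≤n (≤-trans (m≤n+m (suc d) N) N+d≤n)))
  h∼ (mkℚᵘ (+ 0) d)      (*<* (+<+ ()))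
  h∼ (mkℚᵘ ℤ.-[1+ _ ] d) (*<* ())
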